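{- Let $M$ be a matroid with at least two bases and of rank at most $2$. Then $M$ has the Borsuk property.
   Context: All matroids are finite. For a matroid $M$, $\mathcal{B}(M)$ denotes its set of bases, and the distance between two bases $B,B'$ is $|B\triangle B'|$ (symmetric difference); $\operatorname{diam}$ denotes the diameter with respect to this distance. The Borsuk number $f(M)$ is the minimum number of parts in a partition of $\mathcal{B}(M)$ in which every part has diameter strictly smaller than $\operatorname{diam}(\mathcal{B}(M))$; if $M$ has exactly one basis, $f(M):=+\infty$. If $M$ has $n$ elements and $c$ connected components, $M$ has the Borsuk property if $f(M)\le n-c+1$. -}

module Defs where

import Data.Bool.Properties as Bool
open import Data.Fin using (Fin)
import Data.Fin.Properties as Fin
open import Data.Fin.Subset
  using (Subset; inside; outside; _∈_; _⊆_; _⊂_; _∪_; _─_; _-_; ⁅_⁆; ∣_∣)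
open import Data.Fin.Subset.Properties using (_∈?_; _⊆?_; _⊂?_; anySubset?)
open import Data.List
  using (List; []; _∷_; _++_; map; filter; length; allFin; deduplicate; cartesianProductWith)
open import Data.List.Extrema.Nat using (max)
open import Data.Nat using (ℕ; zero; suc; _+_; _∸_; _≤_; _<_)
open import Data.Product using (∃; ∃₂; ∃!; _×_; _,_; ∃-syntax)
open import Data.Sum using (_⊎_)
open import Data.Vec using ([]; _∷_; tabulate)
open import Data.Vec.Properties using (≡-dec)
import Relation.Binary.Construct.Add.Supremum.NonStrict as AddSupremum
open import Relation.Binary.PropositionalEquality using (_≡_; _≢_)
open import Relation.Nullary using (¬_; Dec; does; ¬?; _×-dec_; _⊎-dec_)
open import Relation.Nullary.Construct.Add.Supremum using (_⁺; ⊤⁺; [_])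
open import Relation.Nullary.Decidable using (map′; decidable-stable)
open import Relation.Unary using (Decidable)

open AddSupremum _≤_ public using (_≤⁺_)

private
  variable
    n : ℕ

-- Matroids on a ground set of n elements, given by the basis axioms.
-- Decidability is automatic classically; here it makes the set of bases finite.
record Matroid (n : ℕ) : Set₁ where
  field
    IsBasis  : Subset n → Set
    isBasis? : Decidable IsBasis
    nonempty : ∃ IsBasis
    exchange : ∀ {A B x} → IsBasis A → IsBasis B → x ∈ A ─ B →
               ∃[ y ] y ∈ B ─ A × IsBasis ((A - x) ∪ ⁅ y ⁆)

open Matroid public

-- By the exchange axiom all bases have the same cardinality, so the choice of basis is immaterial.
rank : Matroid n → ℕ
rank M = let (B , _) = nonempty M in ∣ B ∣

AtLeastTwoBases : Matroid n → Set
AtLeastTwoBases M = ∃₂ λ A B → IsBasis M A × IsBasis M B × A ≢ B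

Independent : Matroid n → Subset n → Set
Independent M I = ∃[ B ] IsBasis M B × I ⊆ B

IsCircuit : Matroid n → Subset n → Set
IsCircuit M C = ¬ Independent M C × (∀ D → D ⊂ C → Independent M D)

-- e and f lie in the same connected component.
Connected : Matroid n → Fin n → Fin n → Set
Connected M e f = e ≡ f ⊎ (∃[ C ] IsCircuit M C × e ∈ C × f ∈ C)

independent? : (M : Matroid n) → Decidable (Independent M)
independent? M I = anySubset? λ B → isBasis? M B ×-dec I ⊆? B

isCircuit? : (M : Matroid n) → Decidable (IsCircuit M)
isCircuit? M C = ¬? (independent? M C) ×-dec
  map′ (λ ∄D D D⊂C → decidable-stable (independent? M D) λ ¬indD → ∄D (D , D⊂C , ¬indD))
       (λ all (D , D⊂C , ¬indD) → ¬indD (all D D⊂C))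
       (¬? (anySubset? λ D → D ⊂? C ×-dec ¬? (independent? M D)))

connected? : (M : Matroid n) (e f : Fin n) → Dec (Connected M e f)
connected? M e f =
  e Fin.≟ f ⊎-dec anySubset? λ C → isCircuit? M C ×-dec (e ∈? C ×-dec f ∈? C)

componentOf : Matroid n → Fin n → Subset n
componentOf M e = tabulate λ f → does (connected? M e f)

components : Matroid n → List (Subset n)
components {n} M = deduplicate (≡-dec Bool._≟_) (map (componentOf M) (allFin n))

distance : Subset n → Subset n → ℕ
distance A B = ∣ (A ─ B) ∪ (B ─ A) ∣

diam : List (Subset n) → ℕ
diam 𝓕 = max 0 (cartesianProductWith distance 𝓕 𝓕)

subsets : ∀ n → List (Subset n)
subsets zero    = [] ∷ []
subsets (suc n) = map (inside ∷_) (subsets n) ++ map (outside ∷_) (subsets n)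

bases : Matroid n → List (Subset n)
bases M = filter (isBasis? M) (subsets _)

module _ {k : ℕ} (M : Matroid n) (p : Subset n → Fin k) where

  part : Fin k → List (Subset n)
  part i = filter (λ B → p B Fin.≟ i) (bases M)

  -- p assigns to each basis the index of its part; its values elsewhere are
  -- irrelevant.  The first condition says that all parts are nonempty.
  IsBorsukPartition : Set
  IsBorsukPartition =
    (∀ i → ∃[ B ] IsBasis M B × p B ≡ i) × (∀ i → diam (part i) < diam (bases M))

HasBorsukPartition : Matroid n → ℕ → Set
HasBorsukPartition {n} M k = ∃[ p ] IsBorsukPartition {n} {k} M p

-- IsBorsukNumber M f states that f = f(M), with ⊤⁺ standing for +∞.
data IsBorsukNumber (M : Matroid n) : ℕ ⁺ → Set where
  finite   : ∀ {k} → HasBorsukPartition M k →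
             (∀ {j} → HasBorsukPartition M j → k ≤ j) → IsBorsukNumber M [ k ]
  infinite : ∃! _≡_ (IsBasis M) → IsBorsukNumber M ⊤⁺

-- There are at most n components, so the subtraction does not truncate.
BorsukProperty : Matroid n → Set
BorsukProperty {n} M =
  ∃[ f ] IsBorsukNumber M f × f ≤⁺ [ n ∸ length (components M) + 1 ]

{-# OPTIONS --safe #-}
-- If every element of S shares its component with an element outside S, then c ≤ n − |S|,
-- so colouring the bases with |S| + 1 colours suffices.  Colour a basis B by an element of
-- B ∩ S, with one more colour for the bases avoiding S; when rank M ≤ 2, two bases sharing
-- an element are at distance at most 2.  Call two elements adjacent if some basis contains
-- both.  If there are three pairwise adjacent elements, then all non-loops form one component
-- and S is the set of all of them but one, except when the bases pairwise meet: then they form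
-- a triangle.  Otherwise each non-loop is non-adjacent, hence parallel, to an element of a
-- fixed basis B₀, and S consists of the non-loops outside B₀.
module Submission where

open import Defs
import Data.Bool.Properties as Bool
open import Data.Fin using (Fin; zero; suc; punchOut)
import Data.Fin.Properties as Fin
open import Data.Fin.Subset
  using (Subset; inside; outside; _∈_; _∉_; _⊆_; _∪_; _∩_; _─_; _-_; ∁; ⁅_⁆; ∣_∣; Nonempty)
open import Data.Fin.Subset.Properties
open import Data.List using (List; []; _∷_; map; length; allFin)
open import Data.List.Extrema.Nat using (max<v⁺; xs≤max)
open import Data.List.Membership.Propositional using () renaming (_∈_ to _∈ˡ_)
open import Data.List.Membership.Propositional.Properties
  using (∈-filter⁺; ∈-filter⁻; ∈-map⁺; ∈-map⁻; ∈-++⁺ˡ; ∈-++⁺ʳ; ∈-deduplicate⁻;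
         ∈-cartesianProductWith⁺; ∈-cartesianProductWith⁻)
open import Data.List.Relation.Unary.All as All using (All; []; _∷_)
import Data.List.Relation.Unary.AllPairs as AllPairs
open import Data.List.Relation.Unary.Any using (here)
open import Data.List.Relation.Unary.Unique.Propositional using (Unique)
open import Data.List.Relation.Unary.Unique.DecPropositional.Properties using (deduplicate-!)
open import Data.Nat using (ℕ; zero; suc; _+_; _∸_; _≤_; _<_; z≤n; s≤s; _≤?_; _<?_)
open import Data.Nat.Induction using (<-wellFounded)
open import Data.Nat.Properties
open import Data.Product using (∃; ∃-syntax; _×_; _,_; proj₁; proj₂)
open import Data.Sum using (_⊎_; inj₁; inj₂; [_,_]′; swap)
open import Data.Vec using ([]; _∷_; tabulate; here; there)
open import Data.Vec.Properties using (≡-dec; tabulate-cong; lookup∘tabulate; []=⇒lookup; lookup⇒[]=)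
open import Function using (_∘_; const; mk⇔)
open import Induction.WellFounded using (Acc; acc)
open import Relation.Binary.Construct.Add.Supremum.NonStrict _≤_ using ([_])
open import Relation.Binary.PropositionalEquality
open import Relation.Nullary
open import Relation.Nullary.Construct.Add.Supremum using ([_])
open import Relation.Nullary.Decidable using (map′; decidable-stable; does-⇔; dec-true)
open import Relation.Unary using (Decidable)

private
  variable
    n k : ℕ

-- Subsets of Fin n

∈─⇒∉ : ∀ (p q : Subset n) {x} → x ∈ p ─ q → x ∉ q
∈─⇒∉ (inside ∷ p) (outside ∷ q) here        ()
∈─⇒∉ (_ ∷ p)      (_ ∷ q)       (there x∈r) (there x∈q) = ∈─⇒∉ p q x∈r x∈q

∈-⇒≢ : ∀ (p : Subset n) {x y} → y ∈ p - x → y ≢ x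
∈-⇒≢ p {x} y∈p-x refl = ∈─⇒∉ p ⁅ x ⁆ y∈p-x (x∈⁅x⁆ x)

∣p∣≤1+∣p-x∣ : ∀ (p : Subset n) x → ∣ p ∣ ≤ suc ∣ p - x ∣
∣p∣≤1+∣p-x∣ (inside ∷ p)  zero    = s≤s (≤-reflexive (cong ∣_∣ (sym (p─⊥≡p p))))
∣p∣≤1+∣p-x∣ (outside ∷ p) zero    = m≤n⇒m≤1+n (≤-reflexive (cong ∣_∣ (sym (p─⊥≡p p))))
∣p∣≤1+∣p-x∣ (inside ∷ p)  (suc x) = s≤s (∣p∣≤1+∣p-x∣ p x)
∣p∣≤1+∣p-x∣ (outside ∷ p) (suc x) = ∣p∣≤1+∣p-x∣ p x

∣p∣>0⇒Nonempty : ∀ (p : Subset n) → 1 ≤ ∣ p ∣ → Nonempty p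
∣p∣>0⇒Nonempty {n} p 1≤ with nonempty? p
... | yes ne = ne
... | no  ¬ne = contradiction (trans (cong ∣_∣ (Empty-unique ¬ne)) (∣⊥∣≡0 n)) (m<n⇒n≢0 1≤)

∣p∣≥2⇒∃≢ : ∀ (p : Subset n) x → 2 ≤ ∣ p ∣ → ∃[ y ] y ∈ p × y ≢ x
∣p∣≥2⇒∃≢ p x 2≤ =
  let (y , y∈) = ∣p∣>0⇒Nonempty (p - x) (≤-pred (≤-trans 2≤ (∣p∣≤1+∣p-x∣ p x)))
  in y , p─q⊆p p ⁅ x ⁆ y∈ , ∈-⇒≢ p y∈

x∈p⇒∣p∣≥1 : ∀ {p : Subset n} {x} → x ∈ p → 1 ≤ ∣ p ∣
x∈p⇒∣p∣≥1 x∈p = ≤-trans (s≤s z≤n) (x∈p⇒∣p-x∣<∣p∣ x∈p)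

pair⇒∣p∣≥2 : ∀ {p : Subset n} {x y} → x ≢ y → x ∈ p → y ∈ p → 2 ≤ ∣ p ∣
pair⇒∣p∣≥2 x≢y x∈p y∈p =
  ≤-trans (s≤s (x∈p⇒∣p∣≥1 (x∈p∧x≢y⇒x∈p-y x∈p x≢y))) (x∈p⇒∣p-x∣<∣p∣ y∈p)

∣p∣≤2⇒∈pair : ∀ {p : Subset n} {x y z} → ∣ p ∣ ≤ 2 → x ≢ y → x ∈ p → y ∈ p →
              z ∈ p → z ≡ x ⊎ z ≡ y
∣p∣≤2⇒∈pair {p = p} {x} {y} {z} ∣p∣≤2 x≢y x∈p y∈p z∈p with z Fin.≟ x | z Fin.≟ y
... | yes z≡x | _       = inj₁ z≡x
... | no _    | yes z≡y = inj₂ z≡y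
... | no z≢x  | no z≢y  = contradiction
  (≤-trans (s≤s (pair⇒∣p∣≥2 x≢y (x∈p∧x≢y⇒x∈p-y x∈p (z≢x ∘ sym)) (x∈p∧x≢y⇒x∈p-y y∈p (z≢y ∘ sym))))
           (x∈p⇒∣p-x∣<∣p∣ z∈p))
  (<⇒≱ (s≤s ∣p∣≤2))

⊆∧∣∣≤⇒≡ : ∀ {p q : Subset n} → p ⊆ q → ∣ q ∣ ≤ ∣ p ∣ → p ≡ q
⊆∧∣∣≤⇒≡ {p = p} {q} p⊆q ∣q∣≤∣p∣ = ⊆-antisym p⊆q λ {x} x∈q →
  decidable-stable (x ∈? p) λ x∉p → <⇒≱ (p⊂q⇒∣p∣<∣q∣ (p⊆q , x , x∈q , x∉p)) ∣q∣≤∣p∣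

distance≡ : ∀ (A B : Subset n) → distance A B ≡ ∣ A ─ B ∣ + ∣ B ─ A ∣
distance≡ []            []            = refl
distance≡ (inside ∷ A)  (inside ∷ B)  = distance≡ A B
distance≡ (inside ∷ A)  (outside ∷ B) = cong suc (distance≡ A B)
distance≡ (outside ∷ A) (inside ∷ B)  = trans (cong suc (distance≡ A B)) (sym (+-suc _ _))
distance≡ (outside ∷ A) (outside ∷ B) = distance≡ A B

distance-refl : ∀ (A : Subset n) → distance A A ≡ 0
distance-refl []            = refl
distance-refl (inside ∷ A)  = distance-refl A
distance-refl (outside ∷ A) = distance-refl A

distance≡0⇒≡ : ∀ (A B : Subset n) → distance A B ≡ 0 → A ≡ B
distance≡0⇒≡ []            []            _ = refl
distance≡0⇒≡ (inside ∷ A)  (inside ∷ B)  d = cong (inside ∷_) (distance≡0⇒≡ A B d)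
distance≡0⇒≡ (outside ∷ A) (outside ∷ B) d = cong (outside ∷_) (distance≡0⇒≡ A B d)

-- The shared element drops out of both differences, so the distance is at most 2; the bound 4 is
-- the distance of two disjoint bases of size 2.
common⇒distance<4 : ∀ {A B : Subset n} {s} → ∣ A ∣ ≤ 2 → ∣ B ∣ ≤ 2 → s ∈ A → s ∈ B → distance A B < 4
common⇒distance<4 {A = A} {B} {s} ∣A∣≤2 ∣B∣≤2 s∈A s∈B = begin-strict
  distance A B          ≡⟨ distance≡ A B ⟩
  ∣ A ─ B ∣ + ∣ B ─ A ∣ ≤⟨ +-mono-≤ (drop A B ∣A∣≤2 s∈A s∈B) (drop B A ∣B∣≤2 s∈B s∈A) ⟩
  2                     <⟨ s≤s (s≤s (s≤s z≤n)) ⟩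
  4                     ∎
  where
  open ≤-Reasoning
  drop : ∀ (C D : Subset _) → ∣ C ∣ ≤ 2 → s ∈ C → s ∈ D → ∣ C ─ D ∣ ≤ 1
  drop C D ∣C∣≤2 s∈C s∈D =
    ≤-pred (≤-trans (p∩q≢∅⇒∣p─q∣<∣p∣ C D (s , x∈p∩q⁺ (s∈C , s∈D))) ∣C∣≤2)

disjoint⇒distance≥4 : ∀ {A B : Subset n} → 2 ≤ ∣ A ∣ → 2 ≤ ∣ B ∣ → ¬ Nonempty (A ∩ B) →
                      4 ≤ distance A B
disjoint⇒distance≥4 {A = A} {B} 2≤∣A∣ 2≤∣B∣ ∅ =
  subst (4 ≤_) (sym (distance≡ A B)) (+-mono-≤
    (≤-trans 2≤∣A∣ (p⊆q⇒∣p∣≤∣q∣ λ x∈A → x∈p∧x∉q⇒x∈p─q x∈A λ x∈B → ∅ (_ , x∈p∩q⁺ (x∈A , x∈B))))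
    (≤-trans 2≤∣B∣ (p⊆q⇒∣p∣≤∣q∣ λ x∈B → x∈p∧x∉q⇒x∈p─q x∈B λ x∈A → ∅ (_ , x∈p∩q⁺ (x∈A , x∈B)))))

∈-subsets : ∀ (A : Subset n) → A ∈ˡ subsets n
∈-subsets []            = here refl
∈-subsets (inside ∷ A)  = ∈-++⁺ˡ (∈-map⁺ (inside ∷_) (∈-subsets A))
∈-subsets (outside ∷ A) = ∈-++⁺ʳ _ (∈-map⁺ (outside ∷_) (∈-subsets A))

⟪_⟫ : ∀ {P : Fin n → Set} → Decidable P → Subset n
⟪ P? ⟫ = tabulate (does ∘ P?)

∈⟪⟫⁺ : ∀ {P : Fin n → Set} (P? : Decidable P) {x} → P x → x ∈ ⟪ P? ⟫
∈⟪⟫⁺ P? {x} Px = lookup⇒[]= x _ (trans (lookup∘tabulate _ x) (dec-true (P? x) Px))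

∈⟪⟫⁻ : ∀ {P : Fin n → Set} (P? : Decidable P) {x} → x ∈ ⟪ P? ⟫ → P x
∈⟪⟫⁻ P? {x} x∈ with P? x | trans (sym (lookup∘tabulate (does ∘ P?) x)) ([]=⇒lookup x∈)
... | yes Px | _ = Px

-- The colour stands for the first element of S that lies in B; the last colour means there is none.
colour : (S B : Subset n) → Fin (suc ∣ S ∣)
colour []            _             = zero
colour (inside ∷ S)  (inside ∷ B)  = zero
colour (inside ∷ S)  (outside ∷ B) = suc (colour S B)
colour (outside ∷ S) (_ ∷ B)       = colour S B

-- Colours number the elements of `S` in order, so an equal colour other than the last points both
-- sets to the same element of `S`.
colour-≡ : ∀ (S A B : Subset n) → colour S A ≡ colour S B →
           (∃[ s ] s ∈ S × s ∈ A × s ∈ B) ⊎ (∀ {s} → s ∈ S → s ∉ A × s ∉ B)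
colour-≡ []            _             _             _  = inj₂ λ ()
colour-≡ (inside ∷ S)  (inside ∷ A)  (inside ∷ B)  _  = inj₁ (zero , here , here , here)
colour-≡ (inside ∷ S)  (outside ∷ A) (outside ∷ B) eq with colour-≡ S A B (Fin.suc-injective eq)
... | inj₁ (s , s∈S , s∈A , s∈B) = inj₁ (suc s , there s∈S , there s∈A , there s∈B)
... | inj₂ avoid = inj₂ λ where
  here        → (λ ()) , (λ ())
  (there s∈S) → (λ { (there s∈A) → proj₁ (avoid s∈S) s∈A }) , (λ { (there s∈B) → proj₂ (avoid s∈S) s∈B })
colour-≡ (outside ∷ S) (_ ∷ A)       (_ ∷ B)       eq with colour-≡ S A B eq
... | inj₁ (s , s∈S , s∈A , s∈B) = inj₁ (suc s , there s∈S , there s∈A , there s∈B)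
... | inj₂ avoid = inj₂ λ where
  (there s∈S) → (λ { (there s∈A) → proj₁ (avoid s∈S) s∈A }) , (λ { (there s∈B) → proj₂ (avoid s∈S) s∈B })

-- Distinct entries need distinct representatives, so the one used by the head can be removed from
-- `T` before treating the tail.
unique⇒length≤∣_∣ : ∀ {A : Set} (T : Subset n) (f : Fin n → A) {ys} → Unique ys →
                    All (λ y → ∃[ e ] e ∈ T × y ≡ f e) ys → length ys ≤ ∣ T ∣
unique⇒length≤∣ T ∣ f AllPairs.[]           []                        = z≤n
unique⇒length≤∣ T ∣ f (y≢ys AllPairs.∷ ys!) ((e , e∈T , refl) ∷ reps) =
  ≤-trans (s≤s (unique⇒length≤∣ T - e ∣ f ys! (All.zipWith shrink (y≢ys , reps)))) (x∈p⇒∣p-x∣<∣p∣ e∈T)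
  where
  shrink : ∀ {y} → (f e ≢ y) × (∃[ e′ ] e′ ∈ T × y ≡ f e′) → ∃[ e′ ] e′ ∈ T - e × y ≡ f e′
  shrink (fe≢y , e′ , e′∈T , refl) = e′ , x∈p∧x≢y⇒x∈p-y e′∈T (λ { refl → fe≢y refl }) , refl

-- Finite search and renumbering of colours

least : ∀ {P : ℕ → Set} → Decidable P → ∀ {m} → P m → ∃[ k ] P k × k ≤ m × (∀ {j} → P j → k ≤ j)
least P? {m} Pm with P? 0
least P? {m} Pm | yes P0 = 0 , P0 , z≤n , λ _ → z≤n
least P? {zero} Pm | no ¬P0 = contradiction Pm ¬P0
least {P} P? {suc m} Pm | no ¬P0 =
  let (k , Pk , k≤m , minimal) = least (P? ∘ suc) Pm
  in suc k , Pk , s≤s k≤m , shift minimal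
  where
  shift : ∀ {k} → (∀ {j} → P (suc j) → k ≤ j) → ∀ {j} → P j → suc k ≤ j
  shift minimal {zero}  P0 = contradiction P0 ¬P0
  shift minimal {suc j} Pj = s≤s (minimal Pj)

-- A function on `Subset (suc n)` is a pair of functions on `Subset n`, split by membership of the
-- first element; `resp` stands in for function extensionality.
anyFunction? : ∀ n {Q : (Subset n → Fin k) → Set} → (∀ {p q} → p ≗ q → Q p → Q q) →
               Decidable Q → Dec (∃ Q)
anyFunction? zero resp Q? =
  map′ (λ (i , Qi) → const i , Qi) (λ (p , Qp) → p [] , resp (λ { [] → refl }) Qp)
       (Fin.any? (Q? ∘ const))
anyFunction? {k} (suc n) {Q} resp Q? =
  map′ (λ (p , q , Qpq) → join p q , Qpq)
       (λ (p , Qp) → p ∘ (inside ∷_) , p ∘ (outside ∷_) ,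
                     resp (λ { (inside ∷ _) → refl ; (outside ∷ _) → refl }) Qp)
       (anyFunction? n
         (λ p≗p′ (q , Qpq) → q , resp (λ { (inside ∷ B) → p≗p′ B ; (outside ∷ _) → refl }) Qpq)
         λ p → anyFunction? n
           (λ q≗q′ → resp λ { (inside ∷ _) → refl ; (outside ∷ B) → q≗q′ B })
           λ q → Q? (join p q))
  where
  join : (p q : Subset n → Fin k) → Subset (suc n) → Fin k
  join p q (inside ∷ B)  = p B
  join p q (outside ∷ B) = q B

-- Renumbers the colours other than `i`; the value `zero` at `i` is a dummy, available because at
-- least one other colour remains.
merge : Fin (2 + k) → Fin (2 + k) → Fin (suc k)
merge i x with i Fin.≟ x
... | yes _   = zero
... | no  i≢x = punchOut i≢x

merge-injective : ∀ (i : Fin (2 + k)) {x y} → x ≢ i → y ≢ i → merge i x ≡ merge i y → x ≡ y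
merge-injective i {x} {y} x≢i y≢i eq with i Fin.≟ x | i Fin.≟ y
... | yes i≡x | _       = contradiction (sym i≡x) x≢i
... | no _    | yes i≡y = contradiction (sym i≡y) y≢i
... | no i≢x  | no i≢y  = Fin.punchOut-injective i≢x i≢y eq

-- Colourings and the Borsuk number of an arbitrary matroid

module _ (M : Matroid n) where

  ∈-bases⁺ : ∀ {B} → IsBasis M B → B ∈ˡ bases M
  ∈-bases⁺ = ∈-filter⁺ (isBasis? M) (∈-subsets _)

  distance≤diam : ∀ {𝓕 : List (Subset n)} {A B} → A ∈ˡ 𝓕 → B ∈ˡ 𝓕 → distance A B ≤ diam 𝓕
  distance≤diam A∈ B∈ = All.lookup (xs≤max 0 _) (∈-cartesianProductWith⁺ distance A∈ B∈)

  -- `0 < d` accounts for the default 0 of the maximum, which is the diameter of an empty family.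
  diam< : ∀ {𝓕 : List (Subset n)} {d} → 0 < d →
          (∀ {A B} → A ∈ˡ 𝓕 → B ∈ˡ 𝓕 → distance A B < d) → diam 𝓕 < d
  diam< {𝓕} 0<d close = max<v⁺ 0<d (All.tabulate λ v∈ →
    let (A , B , A∈ , B∈ , v≡) = ∈-cartesianProductWith⁻ distance 𝓕 𝓕 v∈
    in subst (_< _) (sym v≡) (close A∈ B∈))

  IsColouring : (Subset n → Fin k) → Set
  IsColouring p = ∀ {A B} → IsBasis M A → IsBasis M B → p A ≡ p B → distance A B < diam (bases M)

  SmallParts : (Subset n → Fin k) → Set
  SmallParts p = ∀ i → diam (part M p i) < diam (bases M)

  colouring⇒smallParts : (p : Subset n → Fin k) → IsColouring p → SmallParts p
  colouring⇒smallParts p col i = diam<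
    -- A basis compared with itself shows that the diameter is positive.
    (≤-trans (s≤s z≤n) (col (proj₂ (nonempty M)) (proj₂ (nonempty M)) refl))
    λ A∈ B∈ → let (A∈′ , pA) = ∈-filter⁻ (λ B → p B Fin.≟ i) A∈
                  (B∈′ , pB) = ∈-filter⁻ (λ B → p B Fin.≟ i) B∈
              in col (basis A∈′) (basis B∈′) (trans pA (sym pB))
    where
    basis : ∀ {B} → B ∈ˡ bases M → IsBasis M B
    basis B∈ = proj₂ (∈-filter⁻ (isBasis? M) {xs = subsets n} B∈)

  smallParts⇒colouring : (p : Subset n → Fin k) → SmallParts p → IsColouring p
  smallParts⇒colouring p small bA bB pA≡pB = ≤-trans
    (s≤s (distance≤diam (∈-filter⁺ _ (∈-bases⁺ bA) pA≡pB) (∈-filter⁺ _ (∈-bases⁺ bB) refl)))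
    (small _)

  isColouring? : Decidable (IsColouring {k})
  isColouring? p = map′ (smallParts⇒colouring p) (colouring⇒smallParts p) (Fin.all? λ i → _ <? _)

  Colourable : ℕ → Set
  Colourable k = ∃ (IsColouring {k})

  colourable? : Decidable Colourable
  colourable? k = anyFunction? n
    (λ p≗q col {A} {B} bA bB qA≡qB → col bA bB (trans (p≗q A) (trans qA≡qB (sym (p≗q B)))))
    isColouring?

  dropColour : ∀ {p : Subset n → Fin (suc k)} → IsColouring p → ∀ i →
               ¬ (∃[ B ] IsBasis M B × p B ≡ i) → Colourable k
  -- A single colour is always used, since some basis exists.
  dropColour {zero}      col zero unused = contradiction (_ , proj₂ (nonempty M) , lemma _) unused
    where
    lemma : (j : Fin 1) → j ≡ zero
    lemma zero = refl
  dropColour {suc k} {p} col i    unused = merge i ∘ p , λ bA bB eq →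
    col bA bB (merge-injective i (λ pA≡i → unused (_ , bA , pA≡i)) (λ pB≡i → unused (_ , bB , pB≡i)) eq)

  minimal⇒partition : (∀ {j} → Colourable j → k ≤ j) → Colourable k → HasBorsukPartition M k
  minimal⇒partition {zero}  minimal (p , col) = p , (λ ()) , colouring⇒smallParts p col
  minimal⇒partition {suc k} minimal (p , col) = p , used , colouring⇒smallParts p col
    where
    used : ∀ i → ∃[ B ] IsBasis M B × p B ≡ i
    used i = decidable-stable (anySubset? λ B → isBasis? M B ×-dec p B Fin.≟ i)
      λ unused → 1+n≰n (minimal (dropColour col i unused))

  -- Each component has a representative outside `S`, because an element of `S` can be traded for
  -- its partner `t`.
  ∣components∣≤ : ∀ (S : Subset n) → (∀ {s} → s ∈ S → ∃[ t ] t ∉ S × componentOf M s ≡ componentOf M t) →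
                  length (components M) ≤ n ∸ ∣ S ∣
  ∣components∣≤ S redundant = subst (length (components M) ≤_) (∣∁p∣≡n∸∣p∣ S)
    (unique⇒length≤∣ ∁ S ∣ (componentOf M)
      (deduplicate-! (≡-dec Bool._≟_) (map (componentOf M) (allFin n)))
      (All.tabulate λ C∈ →
        let (e , _ , C≡) = ∈-map⁻ (componentOf M)
                             (∈-deduplicate⁻ (≡-dec Bool._≟_) (map (componentOf M) (allFin n)) C∈)
        in represent e C≡))
    where
    represent : ∀ {C} e → C ≡ componentOf M e → ∃[ t ] t ∈ ∁ S × C ≡ componentOf M t
    represent e C≡ with e ∈? S
    ... | no  e∉S = e , x∉p⇒x∈∁p e∉S , C≡
    ... | yes e∈S = let (t , t∉S , eq) = redundant e∈S in t , x∉p⇒x∈∁p t∉S , trans C≡ eq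

  -- The Borsuk number is found as the least number of colours: a minimal colouring is a Borsuk
  -- partition, and every Borsuk partition is a colouring.
  borsuk : ∀ (S : Subset n) → (∀ {s} → s ∈ S → ∃[ t ] t ∉ S × componentOf M s ≡ componentOf M t) →
           Colourable (suc ∣ S ∣) → BorsukProperty M
  borsuk S redundant colourable =
    let (k , col , k≤ , minimal) = least colourable? colourable
    in [ k ] ,
       finite (minimal⇒partition minimal col)
              (λ (p , _ , small) → minimal (p , smallParts⇒colouring p small)) ,
       [ (begin
         k                              ≤⟨ k≤ ⟩
         suc ∣ S ∣                      ≡⟨ +-comm 1 ∣ S ∣ ⟩
         -- As `∣ S ∣` is at most `n`, the double truncated subtraction is exact.
         ∣ S ∣ + 1                      ≡⟨ cong (_+ 1) (m∸[m∸n]≡n (∣p∣≤n S)) ⟨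
         n ∸ (n ∸ ∣ S ∣) + 1            ≤⟨ +-monoˡ-≤ 1 (∸-monoʳ-≤ n (∣components∣≤ S redundant)) ⟩
         n ∸ length (components M) + 1  ∎) ]
    where open ≤-Reasoning

  distance≤diam-bases : ∀ {A B} → IsBasis M A → IsBasis M B → distance A B ≤ diam (bases M)
  distance≤diam-bases bA bB = distance≤diam (∈-bases⁺ bA) (∈-bases⁺ bB)

  -- Exchanging an `x` of `A ─ B` for a `y` of `B ─ A` does not lower the size of `A` and brings it
  -- closer to `B`, until `A ⊆ B`.
  ∣basis∣≤ : ∀ {A B} → IsBasis M A → IsBasis M B → ∣ A ∣ ≤ ∣ B ∣
  ∣basis∣≤ bA bB = go bA bB (<-wellFounded _)
    where
    go : ∀ {A B} → IsBasis M A → IsBasis M B → Acc _<_ ∣ A ─ B ∣ → ∣ A ∣ ≤ ∣ B ∣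
    go {A} {B} bA bB (acc rec) with nonempty? (A ─ B)
    ... | no ∅ = p⊆q⇒∣p∣≤∣q∣ λ {x} x∈A → decidable-stable (x ∈? B)
                   λ x∉B → ∅ (x , x∈p∧x∉q⇒x∈p─q x∈A x∉B)
    ... | yes (x , x∈A─B) with exchange M bA bB x∈A─B
    ...   | y , y∈B─A , bA′ = ≤-trans ∣A∣≤∣A′∣ (go bA′ bB (rec closer))
      where
      A′ = (A - x) ∪ ⁅ y ⁆
      ∣A∣≤∣A′∣ : ∣ A ∣ ≤ ∣ A′ ∣
      ∣A∣≤∣A′∣ = ≤-trans (∣p∣≤1+∣p-x∣ A x) (p⊂q⇒∣p∣<∣q∣
        (p⊆p∪q ⁅ y ⁆ , y , q⊆p∪q (A - x) ⁅ y ⁆ (x∈⁅x⁆ y) ,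
         ∈─⇒∉ B A y∈B─A ∘ p─q⊆p A ⁅ x ⁆))
      closer : ∣ A′ ─ B ∣ < ∣ A ─ B ∣
      closer = p⊂q⇒∣p∣<∣q∣ (sub , x , x∈A─B , x∉)
        where
        from : ∀ {z} → z ∈ A′ ─ B → z ∈ A - x
        from z∈ with x∈p∪q⁻ (A - x) ⁅ y ⁆ (p─q⊆p A′ B z∈)
        ... | inj₁ z∈A-x = z∈A-x
        ... | inj₂ z∈y with refl ← x∈⁅y⁆⇒x≡y y z∈y = contradiction (p─q⊆p B A y∈B─A) (∈─⇒∉ A′ B z∈)
        sub : A′ ─ B ⊆ A ─ B
        sub z∈ = x∈p∧x∉q⇒x∈p─q (p─q⊆p A ⁅ x ⁆ (from z∈)) (∈─⇒∉ A′ B z∈)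
        x∉ : x ∉ A′ ─ B
        x∉ x∈ = ∈-⇒≢ A (from x∈) refl

-- Matroids of rank at most 2

module _ (M : Matroid n) where

  NonLoop : Fin n → Set
  NonLoop e = ∃[ B ] IsBasis M B × e ∈ B

  nonLoop? : Decidable NonLoop
  nonLoop? e = anySubset? λ B → isBasis? M B ×-dec e ∈? B

  -- In rank 2 the edges of this graph are the bases, and on the non-loops it is complete
  -- multipartite with the parallel classes as parts.
  Adj : Fin n → Fin n → Set
  Adj e f = e ≢ f × (∃[ B ] IsBasis M B × e ∈ B × f ∈ B)

  adj? : ∀ e f → Dec (Adj e f)
  adj? e f = ¬? (e Fin.≟ f) ×-dec anySubset? λ B → isBasis? M B ×-dec (e ∈? B ×-dec f ∈? B)

  adj-sym : ∀ {e f} → Adj e f → Adj f e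
  adj-sym (e≢f , B , bB , e∈B , f∈B) = e≢f ∘ sym , B , bB , f∈B , e∈B

  Triangle : Set
  Triangle = ∃[ a ] ∃[ b ] ∃[ c ] Adj a b × Adj b c × Adj a c

  triangle? : Dec Triangle
  triangle? = Fin.any? λ a → Fin.any? λ b → Fin.any? λ c → adj? a b ×-dec (adj? b c ×-dec adj? a c)

  -- For rank at most 2 this is connectedness by a circuit, extended to e ≡ f.
  _~_ : Fin n → Fin n → Set
  e ~ f = NonLoop e × NonLoop f × (¬ Adj e f ⊎ Triangle)

  ~-sym : ∀ {e f} → e ~ f → f ~ e
  ~-sym (Ne , Nf , inj₁ ¬adj) = Nf , Ne , inj₁ (¬adj ∘ adj-sym)
  ~-sym (Ne , Nf , inj₂ tri)  = Nf , Ne , inj₂ tri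

  -- A proper subset of `C` omits some `x`, so it is covered by the basis given for that `x`.
  isCircuit : ∀ {C} → ¬ Independent M C →
              (∀ {x} → x ∈ C → ∃[ B ] IsBasis M B × (∀ {y} → y ∈ C → y ≢ x → y ∈ B)) → IsCircuit M C
  isCircuit dep ind = dep , λ D (D⊆C , x , x∈C , x∉D) →
    let (B , bB , C-x⊆B) = ind x∈C
    in B , bB , λ y∈D → C-x⊆B (D⊆C y∈D) λ { refl → x∉D y∈D }

  circuit-remove : ∀ {C x} → IsCircuit M C → x ∈ C → ∃[ B ] IsBasis M B × (∀ {y} → y ∈ C → y ≢ x → y ∈ B)
  circuit-remove {C} (_ , ind) x∈C =
    let (B , bB , C-x⊆B) = ind _ (x∈p⇒p-x⊂p x∈C)
    in B , bB , λ y∈C y≢x → C-x⊆B (x∈p∧x≢y⇒x∈p-y y∈C y≢x)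

  -- If a basis `B` contains both `e` and `f`, the dependent set `C` has an element `h` outside `B`.
  -- Removing `e` or `f` from `C` leaves independent sets containing the other one and `h`, which
  -- closes a triangle.
  circuit⇒~ : ∀ {C e f} → IsCircuit M C → e ∈ C → f ∈ C → e ≢ f → e ~ f
  circuit⇒~ {C} {e} {f} circ e∈C f∈C e≢f with circuit-remove circ e∈C | circuit-remove circ f∈C
  ... | B₁ , b₁ , C-e⊆B₁ | B₂ , b₂ , C-f⊆B₂ =
    (B₂ , b₂ , C-f⊆B₂ e∈C e≢f) , (B₁ , b₁ , C-e⊆B₁ f∈C (e≢f ∘ sym)) , rest
    where
    rest : ¬ Adj e f ⊎ Triangle
    rest with adj? e f
    ... | no ¬adj = inj₁ ¬adj
    ... | yes adj@(_ , B , bB , e∈B , f∈B) with Fin.any? (λ h → h ∈? C ×-dec ¬? (h ∈? B))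
    ...   | no ∄h = contradiction
              (B , bB , λ {h} h∈C → decidable-stable (h ∈? B) λ h∉B → ∄h (h , h∈C , h∉B)) (proj₁ circ)
    ...   | yes (h , h∈C , h∉B) = inj₂ (e , f , h , adj ,
              ((λ { refl → h∉B f∈B }) , B₁ , b₁ , C-e⊆B₁ f∈C (e≢f ∘ sym) , C-e⊆B₁ h∈C λ { refl → h∉B e∈B }) ,
              ((λ { refl → h∉B e∈B }) , B₂ , b₂ , C-f⊆B₂ e∈C e≢f , C-f⊆B₂ h∈C λ { refl → h∉B f∈B }))

  -- Adjacency and components in rank at most 2

  module _ (rank≤2 : rank M ≤ 2) where

    private
      B₀ = proj₁ (nonempty M)
      b₀ = proj₂ (nonempty M)

    ∣basis∣≤2 : ∀ {B} → IsBasis M B → ∣ B ∣ ≤ 2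
    ∣basis∣≤2 bB = ≤-trans (∣basis∣≤ M bB b₀) rank≤2

    ∈pair : ∀ {B x y z} → IsBasis M B → x ≢ y → x ∈ B → y ∈ B → z ∈ B → z ≡ x ⊎ z ≡ y
    ∈pair bB = ∣p∣≤2⇒∈pair (∣basis∣≤2 bB)

    adj⇒∣basis∣≥2 : ∀ {e f B} → Adj e f → IsBasis M B → 2 ≤ ∣ B ∣
    adj⇒∣basis∣≥2 (e≢f , A , bA , e∈A , f∈A) bB = ≤-trans (pair⇒∣p∣≥2 e≢f e∈A f∈A) (∣basis∣≤ M bA bB)

    pair⇒≡ : ∀ {A B x y} → IsBasis M A → IsBasis M B → x ≢ y →
             x ∈ A → y ∈ A → x ∈ B → y ∈ B → A ≡ B
    pair⇒≡ {A} {B} bA bB x≢y x∈A y∈A x∈B y∈B = ⊆∧∣∣≤⇒≡ A⊆B (∣basis∣≤ M bB bA)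
      where
      A⊆B : A ⊆ B
      A⊆B z∈A with ∈pair bA x≢y x∈A y∈A z∈A
      ... | inj₁ refl = x∈B
      ... | inj₂ refl = y∈B

    -- Transitivity of parallelism, read contrapositively. If a basis through `b` avoids `a` and
    -- `c`, exchanging its other element `d` towards `A` brings in one of them and keeps `b`.
    adj-split : ∀ {a b c} → Adj a c → NonLoop b → Adj a b ⊎ Adj b c
    adj-split {a} {b} {c} ac@(a≢c , A , bA , a∈A , c∈A) (B , bB , b∈B)
      with b Fin.≟ a | b Fin.≟ c
    ... | yes refl | _        = inj₂ ac
    ... | no _     | yes refl = inj₁ ac
    ... | no b≢a   | no b≢c with a ∈? B | c ∈? B
    ...   | yes a∈B | _       = inj₁ (b≢a ∘ sym , B , bB , a∈B , b∈B)
    ...   | no _    | yes c∈B = inj₂ (b≢c , B , bB , b∈B , c∈B)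
    ...   | no a∉B  | no c∉B with ∣p∣≥2⇒∃≢ B b (adj⇒∣basis∣≥2 ac bB)
    ...     | d , d∈B , d≢b with exchange M bB bA (x∈p∧x∉q⇒x∈p─q d∈B d∉A)
      where
      d∉A : d ∉ A
      d∉A d∈A with ∈pair bA a≢c a∈A c∈A d∈A
      ... | inj₁ refl = a∉B d∈B
      ... | inj₂ refl = c∉B d∈B
    ...       | y , y∈A─B , bB′ with ∈pair bA a≢c a∈A c∈A (p─q⊆p A B y∈A─B)
    ...         | inj₁ refl = inj₁ (b≢a ∘ sym , _ , bB′ , q⊆p∪q (B - d) _ (x∈⁅x⁆ a) ,
                                    p⊆p∪q _ (x∈p∧x≢y⇒x∈p-y b∈B (d≢b ∘ sym)))
    ...         | inj₂ refl = inj₂ (b≢c , _ , bB′ , p⊆p∪q _ (x∈p∧x≢y⇒x∈p-y b∈B (d≢b ∘ sym)) ,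
                                    q⊆p∪q (B - d) _ (x∈⁅x⁆ c))

    ~-trans : ∀ {e f g} → e ~ f → f ~ g → e ~ g
    ~-trans (Ne , _ , inj₂ tri) (_ , Ng , _)        = Ne , Ng , inj₂ tri
    ~-trans (Ne , _ , inj₁ _)   (_ , Ng , inj₂ tri) = Ne , Ng , inj₂ tri
    ~-trans (Ne , Nf , inj₁ ¬ef) (_ , Ng , inj₁ ¬fg) =
      Ne , Ng , inj₁ λ eg → [ ¬ef , ¬fg ]′ (adj-split eg Nf)

    -- By `adj-split`, each of `e` and `f` is non-adjacent to at most one vertex of the triangle, so
    -- one of the three vertices is adjacent to both.
    commonNeighbour : ∀ {e f} → Adj e f → Triangle → ∃[ g ] Adj e g × Adj f g
    commonNeighbour {e} {f} (_ , B , bB , e∈B , f∈B) (a , b , c , ab , bc , ac) =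
      pick (adj? e a) (adj? f a) (adj? e b) (adj? f b)
      where
      Ne = B , bB , e∈B
      Nf = B , bB , f∈B
      via : ∀ {x y z} → NonLoop x → Adj y z → ¬ Adj x y → Adj x z
      via Nx yz ¬xy = [ (λ yx → contradiction (adj-sym yx) ¬xy) , (λ xz → xz) ]′ (adj-split yz Nx)
      pick : Dec (Adj e a) → Dec (Adj f a) → Dec (Adj e b) → Dec (Adj f b) → ∃[ g ] Adj e g × Adj f g
      pick (yes ea) (yes fa) _        _        = a , ea , fa
      pick (no ¬ea) _        _        (yes fb) = b , via Ne ab ¬ea , fb
      pick (no ¬ea) _        _        (no ¬fb) = c , via Ne ac ¬ea , via Nf bc ¬fb
      pick (yes _)  (no ¬fa) (yes eb) _        = b , eb , via Nf ab ¬fa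
      pick (yes _)  (no ¬fa) (no ¬eb) _        = c , via Ne bc ¬eb , via Nf ac ¬fa

    -- Distinct non-adjacent non-loops form a two-element circuit. Adjacent ones form a
    -- three-element circuit with a common neighbour, since no basis has three elements.
    ~⇒connected : ∀ {e f} → e ~ f → Connected M e f
    ~⇒connected {e} {f} (Ne , Nf , q) with e Fin.≟ f | adj? e f
    ... | yes e≡f | _       = inj₁ e≡f
    ... | no e≢f  | no ¬adj = inj₂ (C , isCircuit dep ind , p⊆p∪q _ (x∈⁅x⁆ e) , q⊆p∪q ⁅ e ⁆ _ (x∈⁅x⁆ f))
      where
      C = ⁅ e ⁆ ∪ ⁅ f ⁆
      ∈C⁻ : ∀ {y} → y ∈ C → y ≡ e ⊎ y ≡ f
      ∈C⁻ y∈C with x∈p∪q⁻ ⁅ e ⁆ ⁅ f ⁆ y∈C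
      ... | inj₁ y∈ = inj₁ (x∈⁅y⁆⇒x≡y e y∈)
      ... | inj₂ y∈ = inj₂ (x∈⁅y⁆⇒x≡y f y∈)
      dep : ¬ Independent M C
      dep (B , bB , C⊆B) =
        ¬adj (e≢f , B , bB , C⊆B (p⊆p∪q _ (x∈⁅x⁆ e)) , C⊆B (q⊆p∪q ⁅ e ⁆ _ (x∈⁅x⁆ f)))
      ind : ∀ {x} → x ∈ C → ∃[ B ] IsBasis M B × (∀ {y} → y ∈ C → y ≢ x → y ∈ B)
      ind x∈C with ∈C⁻ x∈C
      ... | inj₁ refl = let (B , bB , f∈B) = Nf in B , bB , λ y∈C y≢e →
                          [ (λ y≡e → contradiction y≡e y≢e) , (λ { refl → f∈B }) ]′ (∈C⁻ y∈C)
      ... | inj₂ refl = let (B , bB , e∈B) = Ne in B , bB , λ y∈C y≢f →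
                          [ (λ { refl → e∈B }) , (λ y≡f → contradiction y≡f y≢f) ]′ (∈C⁻ y∈C)
    ... | no e≢f | yes ef with q
    ...   | inj₁ ¬ef = contradiction ef ¬ef
    ...   | inj₂ tri with commonNeighbour ef tri
    ...     | g , (e≢g , eg) , (f≢g , fg) = inj₂ (C , isCircuit dep ind , e∈C , f∈C)
      where
      C = ⁅ e ⁆ ∪ (⁅ f ⁆ ∪ ⁅ g ⁆)
      e∈C : e ∈ C
      e∈C = p⊆p∪q _ (x∈⁅x⁆ e)
      f∈C : f ∈ C
      f∈C = q⊆p∪q ⁅ e ⁆ _ (p⊆p∪q _ (x∈⁅x⁆ f))
      g∈C : g ∈ C
      g∈C = q⊆p∪q ⁅ e ⁆ _ (q⊆p∪q ⁅ f ⁆ _ (x∈⁅x⁆ g))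
      ∈C⁻ : ∀ {y} → y ∈ C → y ≡ e ⊎ y ≡ f ⊎ y ≡ g
      ∈C⁻ y∈C with x∈p∪q⁻ ⁅ e ⁆ _ y∈C
      ... | inj₁ y∈ = inj₁ (x∈⁅y⁆⇒x≡y e y∈)
      ... | inj₂ y∈ with x∈p∪q⁻ ⁅ f ⁆ ⁅ g ⁆ y∈
      ...   | inj₁ y∈f = inj₂ (inj₁ (x∈⁅y⁆⇒x≡y f y∈f))
      ...   | inj₂ y∈g = inj₂ (inj₂ (x∈⁅y⁆⇒x≡y g y∈g))
      dep : ¬ Independent M C
      dep (B , bB , C⊆B) =
        [ e≢g ∘ sym , f≢g ∘ sym ]′ (∈pair bB e≢f (C⊆B e∈C) (C⊆B f∈C) (C⊆B g∈C))
      ind : ∀ {x} → x ∈ C → ∃[ B ] IsBasis M B × (∀ {y} → y ∈ C → y ≢ x → y ∈ B)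
      ind x∈C with ∈C⁻ x∈C
      ... | inj₁ refl = let (B , bB , f∈B , g∈B) = fg in B , bB , λ y∈C y≢e →
        [ (λ y≡e → contradiction y≡e y≢e) , [ (λ { refl → f∈B }) , (λ { refl → g∈B }) ]′ ]′ (∈C⁻ y∈C)
      ... | inj₂ (inj₁ refl) = let (B , bB , e∈B , g∈B) = eg in B , bB , λ y∈C y≢f →
        [ (λ { refl → e∈B }) , [ (λ y≡f → contradiction y≡f y≢f) , (λ { refl → g∈B }) ]′ ]′ (∈C⁻ y∈C)
      ... | inj₂ (inj₂ refl) = let (B , bB , e∈B , f∈B) = proj₂ ef in B , bB , λ y∈C y≢g →
        [ (λ { refl → e∈B }) , [ (λ { refl → f∈B }) , (λ y≡g → contradiction y≡g y≢g) ]′ ]′ (∈C⁻ y∈C)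

    -- Sharing a circuit is not transitive by definition; the detour through `~` supplies
    -- transitivity.
    connected-resp : ∀ {e f g} → e ~ f → Connected M e g → Connected M f g
    connected-resp e~f (inj₁ refl) = ~⇒connected (~-sym e~f)
    connected-resp {e} {g = g} e~f (inj₂ (C , circ , e∈C , g∈C)) with e Fin.≟ g
    ... | yes refl = ~⇒connected (~-sym e~f)
    ... | no e≢g   = ~⇒connected (~-trans (~-sym e~f) (circuit⇒~ circ e∈C g∈C e≢g))

    ~⇒componentOf≡ : ∀ {e f} → e ~ f → componentOf M e ≡ componentOf M f
    ~⇒componentOf≡ e~f = tabulate-cong λ g →
      does-⇔ (mk⇔ (connected-resp e~f) (connected-resp (~-sym e~f))) (connected? M _ g) (connected? M _ g)

    -- Disjoint bases and the diameter

    FarBases : Set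
    FarBases = ∃[ A ] ∃[ B ] IsBasis M A × IsBasis M B × 4 ≤ distance A B

    farBases? : Dec FarBases
    farBases? = anySubset? λ A → anySubset? λ B → isBasis? M A ×-dec (isBasis? M B ×-dec 4 ≤? distance A B)

    farBases⇒common⇒distance<diam : FarBases → ∀ {A B s} → IsBasis M A → IsBasis M B → s ∈ A → s ∈ B →
                                    distance A B < diam (bases M)
    farBases⇒common⇒distance<diam (_ , _ , bC , bD , 4≤) bA bB s∈A s∈B =
      ≤-trans (common⇒distance<4 (∣basis∣≤2 bA) (∣basis∣≤2 bB) s∈A s∈B)
              (≤-trans 4≤ (distance≤diam-bases M bC bD))

    ¬farBases⇒meet : ¬ FarBases → ∀ {A B} → IsBasis M A → IsBasis M B → 2 ≤ ∣ A ∣ →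
                     ∃[ e ] e ∈ A × e ∈ B
    ¬farBases⇒meet ¬far {A} {B} bA bB 2≤ with nonempty? (A ∩ B)
    ... | yes (e , e∈) = e , x∈p∩q⁻ A B e∈
    ... | no ∅ = contradiction
      (A , B , bA , bB , disjoint⇒distance≥4 2≤ (≤-trans 2≤ (∣basis∣≤ M bA bB)) ∅) ¬far

    -- The three cases of the proof

    module _ (two : AtLeastTwoBases M) where

      -- Two distinct bases make the diameter positive, so a colour class with a single basis is
      -- always admissible.
      ≡⇒distance<diam : ∀ {A B : Subset n} → A ≡ B → distance A B < diam (bases M)
      ≡⇒distance<diam {A} refl =
        let (C , D , bC , bD , C≢D) = two
        in subst (_< diam (bases M)) (sym (distance-refl A))
             (≤-trans (n≢0⇒n>0 (C≢D ∘ distance≡0⇒≡ C D)) (distance≤diam-bases M bC bD))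

      borsuk-triangle-far : Triangle → FarBases → BorsukProperty M
      borsuk-triangle-far tri@(a , _ , _ , ab@(_ , A , bA , a∈A , _) , _) far = borsuk M S
        (λ s∈S → a , (λ a∈S → ∈-⇒≢ N a∈S refl) ,
          ~⇒componentOf≡ (∈⟪⟫⁻ nonLoop? (p─q⊆p N ⁅ a ⁆ s∈S) , (A , bA , a∈A) , inj₂ tri))
        (colour S , close)
        where
        N = ⟪ nonLoop? ⟫
        S = N - a
        close : IsColouring M (colour S)
        close {B} {C} bB bC eq with colour-≡ S B C eq
        ... | inj₁ (_ , _ , s∈B , s∈C) = farBases⇒common⇒distance<diam far bB bC s∈B s∈C
        ... | inj₂ avoid =
          -- The last colour never occurs: a basis has an element other than `a`, and that element
          -- lies in `S`.
          let (d , d∈B , d≢a) = ∣p∣≥2⇒∃≢ B a (adj⇒∣basis∣≥2 ab bB)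
          in contradiction d∈B (proj₁ (avoid (x∈p∧x≢y⇒x∈p-y (∈⟪⟫⁺ nonLoop? (B , bB , d∈B)) d≢a)))

      -- Bases pairwise meet, so the non-loops are a, b, c only and the bases are the
      -- edges of the triangle; colouring by the complement separates all three of them.
      borsuk-triangle-near : Triangle → ¬ FarBases → BorsukProperty M
      borsuk-triangle-near
        tri@(a , b , c , ab@(a≢b , B₁ , b₁ , a∈B₁ , _) , bc@(b≢c , B₂ , b₂ , b∈B₂ , c∈B₂) , ac@(a≢c , _)) ¬far =
        borsuk M S redundant (colour S ∘ ∁ , λ bA bB eq → ≡⇒distance<diam (separate bA bB eq))
        where
        S = ⁅ b ⁆ ∪ ⁅ c ⁆
        b∈S : b ∈ S
        b∈S = p⊆p∪q _ (x∈⁅x⁆ b)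
        c∈S : c ∈ S
        c∈S = q⊆p∪q ⁅ b ⁆ _ (x∈⁅x⁆ c)
        ∈S⁻ : ∀ {s} → s ∈ S → s ≡ b ⊎ s ≡ c
        ∈S⁻ s∈S with x∈p∪q⁻ ⁅ b ⁆ ⁅ c ⁆ s∈S
        ... | inj₁ s∈ = inj₁ (x∈⁅y⁆⇒x≡y b s∈)
        ... | inj₂ s∈ = inj₂ (x∈⁅y⁆⇒x≡y c s∈)
        Na : NonLoop a
        Na = B₁ , b₁ , a∈B₁
        redundant : ∀ {s} → s ∈ S → ∃[ t ] t ∉ S × componentOf M s ≡ componentOf M t
        redundant s∈S = a , ([ a≢b , a≢c ]′ ∘ ∈S⁻) , ~⇒componentOf≡ (nonLoop (∈S⁻ s∈S) , Na , inj₂ tri)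
          where
          nonLoop : ∀ {s} → s ≡ b ⊎ s ≡ c → NonLoop s
          nonLoop (inj₁ refl) = B₂ , b₂ , b∈B₂
          nonLoop (inj₂ refl) = B₂ , b₂ , c∈B₂

        edges-meet : ∀ {x y z w} → Adj x y → Adj z w → x ≡ z ⊎ x ≡ w ⊎ y ≡ z ⊎ y ≡ w
        edges-meet xy@(x≢y , C , bC , x∈C , y∈C) (z≢w , D , bD , z∈D , w∈D)
          with ¬farBases⇒meet ¬far bC bD (adj⇒∣basis∣≥2 xy bC)
        ... | e , e∈C , e∈D with ∈pair bC x≢y x∈C y∈C e∈C | ∈pair bD z≢w z∈D w∈D e∈D
        ...   | inj₁ refl | inj₁ refl = inj₁ refl
        ...   | inj₁ refl | inj₂ refl = inj₂ (inj₁ refl)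
        ...   | inj₂ refl | inj₁ refl = inj₂ (inj₂ (inj₁ refl))
        ...   | inj₂ refl | inj₂ refl = inj₂ (inj₂ (inj₂ refl))

        -- By `adj-split`, `z` is adjacent to `a` or to `b`, and that edge has to meet the opposite
        -- edge of the triangle.
        nonLoop⁻ : ∀ {z} → NonLoop z → z ≡ a ⊎ z ≡ b ⊎ z ≡ c
        nonLoop⁻ Nz with adj-split ab Nz
        ... | inj₁ az with edges-meet az bc
        ...   | inj₁ a≡b               = contradiction a≡b a≢b
        ...   | inj₂ (inj₁ a≡c)        = contradiction a≡c a≢c
        ...   | inj₂ (inj₂ z≡b⊎z≡c)    = inj₂ z≡b⊎z≡c
        nonLoop⁻ Nz | inj₂ zb with edges-meet zb ac
        ...   | inj₁ z≡a               = inj₁ z≡a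
        ...   | inj₂ (inj₁ z≡c)        = inj₂ (inj₂ z≡c)
        ...   | inj₂ (inj₂ (inj₁ b≡a)) = contradiction (sym b≡a) a≢b
        ...   | inj₂ (inj₂ (inj₂ b≡c)) = contradiction b≡c b≢c

        missing⇒∋ : ∀ {B x y s} → IsBasis M B → (∀ {z} → NonLoop z → z ≡ x ⊎ z ≡ y ⊎ z ≡ s) → s ∉ B → x ∈ B
        missing⇒∋ {B} {x} {y} bB only s∉B with ∣p∣≥2⇒∃≢ B y (adj⇒∣basis∣≥2 ab bB)
        ... | d , d∈B , d≢y with only (B , bB , d∈B)
        ...   | inj₁ refl        = d∈B
        ...   | inj₂ (inj₁ d≡y)  = contradiction d≡y d≢y
        ...   | inj₂ (inj₂ refl) = contradiction d∈B s∉B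

        missing⇒≡ : ∀ {A B x y s} → x ≢ y → (∀ {z} → NonLoop z → z ≡ x ⊎ z ≡ y ⊎ z ≡ s) →
                    IsBasis M A → IsBasis M B → s ∉ A → s ∉ B → A ≡ B
        missing⇒≡ {x = x} {y} {s} x≢y only bA bB s∉A s∉B = pair⇒≡ bA bB x≢y
          (missing⇒∋ bA only s∉A) (missing⇒∋ bA only′ s∉A) (missing⇒∋ bB only s∉B) (missing⇒∋ bB only′ s∉B)
          where
          only′ : ∀ {z} → NonLoop z → z ≡ y ⊎ z ≡ x ⊎ z ≡ s
          only′ Nz = [ inj₂ ∘ inj₁ , [ inj₁ , inj₂ ∘ inj₂ ]′ ]′ (only Nz)

        separate : ∀ {A B} → IsBasis M A → IsBasis M B → colour S (∁ A) ≡ colour S (∁ B) → A ≡ B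
        separate {A} {B} bA bB eq with colour-≡ S (∁ A) (∁ B) eq
        -- Neither complement meets `S`, so both bases contain `b` and `c`.
        ... | inj₂ avoid = pair⇒≡ bA bB b≢c
          (x∉∁p⇒x∈p (proj₁ (avoid b∈S))) (x∉∁p⇒x∈p (proj₁ (avoid c∈S)))
          (x∉∁p⇒x∈p (proj₂ (avoid b∈S))) (x∉∁p⇒x∈p (proj₂ (avoid c∈S)))
        -- Both bases miss `s`, so both consist of the other two vertices.
        ... | inj₁ (s , s∈S , s∈∁A , s∈∁B) with ∈S⁻ s∈S
        ...   | inj₁ refl = missing⇒≡ a≢c (λ Nz → [ inj₁ , inj₂ ∘ swap ]′ (nonLoop⁻ Nz))
                              bA bB (x∈∁p⇒x∉p s∈∁A) (x∈∁p⇒x∉p s∈∁B)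
        ...   | inj₂ refl = missing⇒≡ a≢b nonLoop⁻ bA bB (x∈∁p⇒x∉p s∈∁A) (x∈∁p⇒x∉p s∈∁B)

      -- The last colour is left to `B₀` alone. Bases of any other common colour share an element
      -- outside `B₀`: this makes them close enough if the diameter is at least 4, and equal
      -- otherwise.
      borsuk-no-triangle : ¬ Triangle → BorsukProperty M
      borsuk-no-triangle ¬tri = borsuk M S redundant (colour S , close farBases?)
        where
        N = ⟪ nonLoop? ⟫
        S = N ─ B₀

        redundant : ∀ {s} → s ∈ S → ∃[ t ] t ∉ S × componentOf M s ≡ componentOf M t
        redundant {s} s∈S with ∈⟪⟫⁻ nonLoop? (p─q⊆p N B₀ s∈S) | Fin.any? (λ t → t ∈? B₀ ×-dec ¬? (adj? s t))
        ... | Ns | yes (t , t∈B₀ , ¬st) =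
          t , (λ t∈S → ∈─⇒∉ N B₀ t∈S t∈B₀) , ~⇒componentOf≡ (Ns , (B₀ , b₀ , t∈B₀) , inj₁ ¬st)
        -- Here `s` is adjacent to all of `B₀`, which therefore has two elements, and these form a
        -- triangle with `s`.
        ... | (B , bB , s∈B) | no ∄t =
          let (t , t∈B₀)       = ∣p∣>0⇒Nonempty B₀ (≤-trans (x∈p⇒∣p∣≥1 s∈B) (∣basis∣≤ M bB b₀))
              (u , u∈B₀ , u≢t) = ∣p∣≥2⇒∃≢ B₀ t (adj⇒∣basis∣≥2 (adj t∈B₀) b₀)
          in contradiction (s , t , u , adj t∈B₀ , (u≢t ∘ sym , B₀ , b₀ , t∈B₀ , u∈B₀) , adj u∈B₀) ¬tri
          where
          adj : ∀ {t} → t ∈ B₀ → Adj s t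
          adj {t} t∈B₀ = decidable-stable (adj? s t) λ ¬st → ∄t (t , t∈B₀ , ¬st)

        -- Elements of a basis are non-loops, so avoiding `S` means lying inside `B₀`; equal sizes
        -- do the rest.
        avoid⇒≡B₀ : ∀ {A} → IsBasis M A → (∀ {s} → s ∈ S → s ∉ A) → A ≡ B₀
        avoid⇒≡B₀ {A} bA avoid = ⊆∧∣∣≤⇒≡
          (λ {x} x∈A → decidable-stable (x ∈? B₀) λ x∉B₀ →
            avoid (x∈p∧x∉q⇒x∈p─q (∈⟪⟫⁺ nonLoop? (A , bA , x∈A)) x∉B₀) x∈A)
          (∣basis∣≤ M b₀ bA)

        -- Without disjoint bases, a basis through s ∉ B₀ is {s , x} with x ∈ B₀, and two
        -- different such x would form a triangle with s.
        near⇒⊆ : ¬ FarBases → ∀ {A B s} → IsBasis M A → IsBasis M B → s ∉ B₀ → s ∈ A → s ∈ B → A ⊆ B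
        near⇒⊆ ¬far {A} {B} {s} bA bB s∉B₀ s∈A s∈B {x} x∈A with x Fin.≟ s
        ... | yes refl = s∈B
        ... | no x≢s =
          let (y , y∈B , y≢s) = ∣p∣≥2⇒∃≢ B s (adj⇒∣basis∣≥2 (x≢s , A , bA , x∈A , s∈A) bB)
          in decidable-stable (x ∈? B) λ x∉B → ¬tri (s , x , y ,
               (x≢s ∘ sym , A , bA , s∈A , x∈A) ,
               ((λ x≡y → x∉B (subst (_∈ B) (sym x≡y) y∈B)) , B₀ , b₀ , ∈B₀ bA s∈A x∈A x≢s , ∈B₀ bB s∈B y∈B y≢s) ,
               (y≢s ∘ sym , B , bB , s∈B , y∈B))
          where
          ∈B₀ : ∀ {C z} → IsBasis M C → s ∈ C → z ∈ C → z ≢ s → z ∈ B₀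
          ∈B₀ bC s∈C z∈C z≢s with ¬farBases⇒meet ¬far bC b₀ (pair⇒∣p∣≥2 z≢s z∈C s∈C)
          ... | e , e∈C , e∈B₀ with ∈pair bC z≢s z∈C s∈C e∈C
          ...   | inj₁ refl = e∈B₀
          ...   | inj₂ refl = contradiction e∈B₀ s∉B₀

        close : Dec FarBases → IsColouring M (colour S)
        close far?      {A} {B} bA bB eq with colour-≡ S A B eq
        close far?      bA bB eq | inj₂ avoid = ≡⇒distance<diam
          (trans (avoid⇒≡B₀ bA (proj₁ ∘ avoid)) (sym (avoid⇒≡B₀ bB (proj₂ ∘ avoid))))
        close (yes far) bA bB eq | inj₁ (_ , _ , s∈A , s∈B) =
          farBases⇒common⇒distance<diam far bA bB s∈A s∈B
        close (no ¬far) bA bB eq | inj₁ (s , s∈S , s∈A , s∈B) = ≡⇒distance<diam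
          (⊆-antisym (near⇒⊆ ¬far bA bB (∈─⇒∉ N B₀ s∈S) s∈A s∈B) (near⇒⊆ ¬far bB bA (∈─⇒∉ N B₀ s∈S) s∈B s∈A))

theorem2 : ∀ {n : ℕ} (M : Matroid n) → AtLeastTwoBases M → rank M ≤ 2 → BorsukProperty M
theorem2 M two rank≤2 with triangle? M | farBases? M rank≤2
-- Rank 1 falls under this case, as adjacency requires a basis with two elements.
... | no ¬tri | _        = borsuk-no-triangle M rank≤2 two ¬tri
... | yes tri | yes far  = borsuk-triangle-far M rank≤2 two tri far
... | yes tri | no ¬far  = borsuk-triangle-near M rank≤2 two tri ¬far
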